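{- Let ${\cal D}_2$ be the class of all $2$-regular connected graphs $H$ for which there exist a connected graph $G$ and a positive integer $k$ with $H\cong D_k(G)$. Then, up to isomorphism, ${\cal D}_2=\{C_6,C_8\}$.
   Context: Graphs are finite and simple, with nonempty vertex set. $C_m$ denotes the cycle on $m$ vertices. A set $S\subseteq V(G)$ is a dominating set of $G$ if every vertex in $V(G)\setminus S$ is adjacent to at least one vertex of $S$. For a positive integer $k$, the $k$-dominating graph $D_k(G)$ is the graph whose vertices are the dominating sets of $G$ of cardinality at most $k$, two of them being adjacent if and only if one is obtained from the other by adding or deleting a single vertex. $\cong$ denotes graph isomorphism. -}

module Defs where

open import Data.Fin.Base using (Fin; toℕ)
open import Data.Fin.Properties using (toℕ<n)
open import Data.Fin.Subset using (Subset; _∈_; _∉_; _∪_; _-_; ⁅_⁆; ∣_∣)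
open import Data.Fin.Subset.Properties using (x∈⁅x⁆; x∈p∪q⁺; x∈p⇒∣p-x∣<∣p∣)
open import Data.Nat.Base using (ℕ; suc; _≤_; _<_; NonZero; >-nonZero; s≤s; z≤n)
open import Data.Nat.DivMod using (_%_; m<n⇒m%n≡m; n%n≡0)
open import Data.Nat.Properties using (_≟_; _≤?_; 1+n≢n; m≤n⇒m<n∨m≡n; ≤-trans; <⇒≢)
open import Data.Product.Base using (Σ-syntax; ∃-syntax; _×_; _,_)
open import Data.Refinement using (Refinement-syntax; value)
open import Data.Sum.Base using (_⊎_; inj₁; inj₂; swap)
open import Data.Vec.Base using (tabulate)
open import Function.Bundles using (_↔_; _⇔_; Inverse)
open import Level using (0ℓ)
open import Relation.Binary.Construct.Closure.ReflexiveTransitive using (Star)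
open import Relation.Binary.Construct.Closure.Symmetric using (SymClosure; symmetric; fwd; bwd)
open import Relation.Binary.Core using (Rel)
open import Relation.Binary.Definitions using (Symmetric; Decidable)
open import Relation.Binary.PropositionalEquality using (_≡_; refl; sym; trans; cong; subst)
open import Relation.Nullary using (¬_; does)
open import Relation.Nullary.Decidable using (True; toWitness; _⊎-dec_)

record Graph : Set₁ where
  field
    Vertex : Set
    Adj    : Rel Vertex 0ℓ
    symm   : Symmetric Adj
    irrefl : ∀ v → ¬ Adj v v

open Graph public using (Vertex)

infix 4 _≅_
record _≅_ (G H : Graph) : Set where
  field
    bijection : Vertex G ↔ Vertex H
    adjacency : ∀ u v → Graph.Adj G u v ⇔
                        Graph.Adj H (Inverse.to bijection u) (Inverse.to bijection v)

-- Finite simple graphs with nonempty vertex set, labelled by Fin order.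
-- Decidability of adjacency, automatic classically, is part of the data.
record FiniteGraph : Set₁ where
  field
    order    : ℕ
    nonEmpty : NonZero order
    Adj      : Rel (Fin order) 0ℓ
    adj?     : Decidable Adj
    symm     : Symmetric Adj
    irrefl   : ∀ v → ¬ Adj v v

  graph : Graph
  graph = record { Vertex = Fin order ; Adj = Adj ; symm = symm ; irrefl = irrefl }

  neighbours : Fin order → Subset order
  neighbours v = tabulate λ u → does (adj? v u)

  degree : Fin order → ℕ
  degree v = ∣ neighbours v ∣

  Regular : ℕ → Set
  Regular r = ∀ v → degree v ≡ r

  Connected : Set
  Connected = ∀ u v → Star Adj u v

  Dominating : Subset order → Set
  Dominating S = ∀ v → v ∉ S → ∃[ u ] u ∈ S × Adj v u

open FiniteGraph public using (graph; Regular; Connected)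

ObtainedByOneChange : ∀ {n} → Rel (Subset n) 0ℓ
ObtainedByOneChange S T = ∃[ v ] ((v ∉ S × T ≡ S ∪ ⁅ v ⁆) ⊎ (v ∈ S × T ≡ S - v))

private
  noChange : ∀ {n} (S : Subset n) → ¬ ObtainedByOneChange S S
  noChange S (v , inj₁ (v∉S , eq)) =
    v∉S (subst (v ∈_) (sym eq) (x∈p∪q⁺ (inj₂ (x∈⁅x⁆ v))))
  noChange S (v , inj₂ (v∈S , eq)) = <⇒≢ (x∈p⇒∣p-x∣<∣p∣ v∈S) (cong ∣_∣ (sym eq))

-- The refinement type keeps its proof component irrelevant, so two vertices
-- are propositionally equal exactly when their underlying sets are.
-- There may be no vertices at all, so the result is only a Graph.
D : ℕ → FiniteGraph → Graph
D k G = record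
  { Vertex = [ S ∈ Subset order ∣ Dominating S × ∣ S ∣ ≤ k ]
  ; Adj    = λ S T → SymClosure ObtainedByOneChange (value S) (value T)
  ; symm   = symmetric ObtainedByOneChange
  ; irrefl = λ { S (fwd c) → noChange (value S) c ; S (bwd c) → noChange (value S) c }
  }
  where open FiniteGraph G

private
  suc%≢ : ∀ {m i} .{{_ : NonZero m}} → 2 ≤ m → i < m → ¬ (i ≡ suc i % m)
  suc%≢ {m} 2≤m i<m eq with m≤n⇒m<n∨m≡n i<m
  ... | inj₁ 1+i<m = 1+n≢n (sym (trans eq (m<n⇒m%n≡m 1+i<m)))
  suc%≢ {m} 2≤m i<m eq | inj₂ refl with trans eq (n%n≡0 m)
  suc%≢ (s≤s ()) i<m eq | inj₂ refl | refl

-- The implicit bound is solved automatically for numerals m ≥ 3.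
C : (m : ℕ) {3≤m : True (3 ≤? m)} → FiniteGraph
C m {3≤m} = record
  { order    = m
  ; nonEmpty = m≢0
  ; Adj      = λ i j → Next i j ⊎ Next j i
  ; adj?     = λ i j → next? i j ⊎-dec next? j i
  ; symm     = swap
  ; irrefl   = λ { i (inj₁ e) → no-loop i e ; i (inj₂ e) → no-loop i e }
  }
  where
  2≤m : 2 ≤ m
  2≤m = ≤-trans (s≤s (s≤s z≤n)) (toWitness 3≤m)

  instance
    m≢0 : NonZero m
    m≢0 = >-nonZero (≤-trans (s≤s z≤n) 2≤m)

  Next : Rel (Fin m) 0ℓ
  Next i j = toℕ j ≡ suc (toℕ i) % m

  next? : Decidable Next
  next? i j = toℕ j ≟ suc (toℕ i) % m

  no-loop : ∀ i → ¬ Next i i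
  no-loop i = suc%≢ 2≤m (toℕ<n i)

𝓓₂ : FiniteGraph → Set₁
𝓓₂ H = Regular H 2 × Connected H ×
       Σ[ G ∈ FiniteGraph ] Connected G × (∃[ k ] 1 ≤ k × graph H ≅ D k G)

{-# OPTIONS --safe #-}

-- A dominating set S with ∣ S ∣ < k is adjacent to S ∪ ⁅ v ⁆ for every v ∉ S.  If D k G is
-- 2-regular, S therefore misses at most two vertices; as D k G has an edge, such an S exists,
-- and since ⊤ cannot be a vertex of D k G, this forces k = n - 1.  The sets ⊤ - v are then all
-- feasible, and the neighbours of ⊤ - v are the dominating sets ⊤ - v - u: the pairs {v , u}
-- with dominating complement form a 2-regular graph on the vertices of G, of which D k G is
-- the subdivision.  A pair fails to have a dominating complement only if it is an edge of G
-- with a leaf at one end.  Every vertex lies in n - 3 such pairs, so n ≥ 5 would make every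
-- vertex a non-leaf.  Hence n ∈ {3 , 4}, and subdividing a triangle or a quadrilateral gives
-- C 6 or C 8.

module Submission where

open import Defs
import Data.Bool.Properties as Bool
open import Data.Empty using (⊥; ⊥-elim)
open import Data.Fin.Base using (Fin; zero; suc; inject₁; toℕ)
open import Data.Fin.Induction using (<-weakInduction)
open import Data.Fin.Patterns using (0F; 1F; 2F; 3F)
open import Data.Fin.Properties using (all?; any?; injective⇒≤) renaming (_≟_ to _≟ᶠ_)
open import Data.Fin.Subset
  using (Subset; inside; outside; _∈_; _∉_; _∪_; _-_; ⁅_⁆; ∣_∣; ⊤; ∁; Empty)
open import Data.Fin.Subset.Properties
open import Data.Irrelevant using ([_])
open import Data.Nat.Base using (ℕ; suc; _+_; _≤_; _<_; z≤n; s≤s; s≤s⁻¹)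
open import Data.Nat.Properties
  using (≤-refl; ≤-reflexive; ≤-trans; ≤-antisym; <⇒≤; <⇒≱; ≰⇒>; suc-injective; 1+n≢n; n≮n; n≮0;
         m≤m+n; m+n≤o⇒m≤o∸n; _≟_; _≤?_; _<?_)
open import Data.Product.Base using (_×_; _,_; proj₁; proj₂; ∃-syntax)
open import Data.Refinement using (value; value-injective) renaming (_,_ to _∶_)
open import Data.Sum.Base using (_⊎_; inj₁; inj₂; [_,_]′; swap)
open import Data.Vec.Base using (Vec; []; _∷_; lookup; here; there)
import Data.Vec.Membership.DecPropositional as DecMembership
open import Data.Vec.Membership.Propositional.Properties using (∈-lookup)
open import Data.Vec.Properties using (≡-dec; lookup∘tabulate; []=⇒lookup; lookup⇒[]=)
open import Data.Vec.Relation.Unary.All using (All; []; _∷_) renaming (lookup to All-lookup)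
open import Data.Vec.Relation.Unary.AllPairs using (allPairs?; []; _∷_)
open import Data.Vec.Relation.Unary.Any using (index)
open import Data.Vec.Relation.Unary.Any.Properties using (lookup-index)
open import Data.Vec.Relation.Unary.Unique.Propositional using (Unique)
open import Data.Vec.Relation.Unary.Unique.Propositional.Properties using (lookup-injective)
open import Function.Base using (_∘_; case_of_)
open import Function.Bundles using (_⇔_; mk⇔; mk↔ₛ′; Inverse; Equivalence)
open import Function.Construct.Composition using (_⇔-∘_; _↔-∘_)
open import Function.Construct.Symmetry using (⇔-sym; ↔-sym)
open import Level using (0ℓ)
open import Relation.Binary.Construct.Closure.ReflexiveTransitive
  using (Star; ε; _◅_; _◅◅_; gmap; reverse)
open import Relation.Binary.Construct.Closure.Symmetric using (SymClosure; fwd; bwd)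
open import Relation.Binary.Core using (Rel)
open import Relation.Binary.Definitions using (Symmetric; Decidable; DecidableEquality)
open import Relation.Binary.PropositionalEquality
  using (_≡_; _≢_; refl; sym; trans; cong; subst; subst₂; ≢-sym)
open import Relation.Nullary using (¬_; Dec; yes; no; does; contradiction)
open import Relation.Nullary.Decidable
  using (map′; ¬?; _×-dec_; _⊎-dec_; _→-dec_; from-yes; recompute; decidable-stable;
         toWitness; dec-true; True)

private variable
  n m : ℕ

-- Subsets of a finite set

module _ {n : ℕ} where

  infix 4 _≟ˢ_
  _≟ˢ_ : DecidableEquality (Subset n)
  _≟ˢ_ = ≡-dec Bool._≟_

  open DecMembership _≟ˢ_ public using () renaming (_∈_ to _∈ᵛ_; _∈?_ to _∈ᵛ?_)

-- Makes statements about all subsets of a concrete `Fin n` provable by evaluation, which the finite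
-- tables below rely on.
allSubsets? : {P : Subset n → Set} → (∀ S → Dec (P S)) → Dec (∀ S → P S)
allSubsets? P? = map′
  (λ ¬∃ S → decidable-stable (P? S) λ ¬p → ¬∃ (S , ¬p))
  (λ ∀P (S , ¬p) → ¬p (∀P S))
  (¬? (anySubset? (¬? ∘ P?)))

x∉p-x : ∀ (p : Subset n) x → x ∉ p - x
x∉p-x (_ ∷ _) zero ()
x∉p-x (_ ∷ p) (suc x) (there x∈) = x∉p-x p x x∈

x∈p-y⇒x≢y : ∀ {p : Subset n} {x y} → x ∈ p - y → x ≢ y
x∈p-y⇒x≢y {p = p} x∈ refl = x∉p-x p _ x∈

x∈p-y⇒x∈p : ∀ {p : Subset n} {x y} → x ∈ p - y → x ∈ p
x∈p-y⇒x∈p {p = p} {y = y} = p─q⊆p p ⁅ y ⁆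

x∈p∪⁅y⁆⇒x∈p : ∀ {p : Subset n} {x y} → x ∈ p ∪ ⁅ y ⁆ → x ≢ y → x ∈ p
x∈p∪⁅y⁆⇒x∈p {p = p} {y = y} x∈ x≢y with x∈p∪q⁻ p ⁅ y ⁆ x∈
... | inj₁ x∈p = x∈p
... | inj₂ x∈y = contradiction (x∈⁅y⁆⇒x≡y y x∈y) x≢y

p∪⁅x⁆-x≡p : ∀ {p : Subset n} {x} → x ∉ p → (p ∪ ⁅ x ⁆) - x ≡ p
p∪⁅x⁆-x≡p {p = p} {x} x∉p = ⊆-antisym
  (λ y∈ → x∈p∪⁅y⁆⇒x∈p (x∈p-y⇒x∈p y∈) (x∈p-y⇒x≢y y∈))
  (λ y∈p → x∈p∧x≢y⇒x∈p-y (x∈p∪q⁺ (inj₁ y∈p)) λ { refl → x∉p y∈p })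

p-x∪⁅x⁆≡p : ∀ {p : Subset n} {x} → x ∈ p → (p - x) ∪ ⁅ x ⁆ ≡ p
p-x∪⁅x⁆≡p {p = p} {x} x∈p = ⊆-antisym ⊆₁ ⊆₂
  where
  ⊆₁ : ∀ {y} → y ∈ (p - x) ∪ ⁅ x ⁆ → y ∈ p
  ⊆₁ {y} y∈ with x∈p∪q⁻ (p - x) ⁅ x ⁆ y∈
  ... | inj₁ h = x∈p-y⇒x∈p h
  ... | inj₂ h = subst (_∈ p) (sym (x∈⁅y⁆⇒x≡y x h)) x∈p
  ⊆₂ : ∀ {y} → y ∈ p → y ∈ (p - x) ∪ ⁅ x ⁆
  ⊆₂ {y} y∈p with y ≟ᶠ x
  ... | yes refl = x∈p∪q⁺ (inj₂ (x∈⁅x⁆ x))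
  ... | no y≢x = x∈p∪q⁺ (inj₁ (x∈p∧x≢y⇒x∈p-y y∈p y≢x))

p-x≡p-y⇒x≡y : ∀ {p : Subset n} {x y} → x ∈ p → p - x ≡ p - y → x ≡ y
p-x≡p-y⇒x≡y {p = p} {x} {y} x∈p eq with x ≟ᶠ y
... | yes x≡y = x≡y
... | no x≢y = contradiction (subst (x ∈_) (sym eq) (x∈p∧x≢y⇒x∈p-y x∈p x≢y)) (x∉p-x p x)

p∪⁅x⁆≡p∪⁅y⁆⇒x≡y : ∀ {p : Subset n} {x y} → x ∉ p → p ∪ ⁅ x ⁆ ≡ p ∪ ⁅ y ⁆ → x ≡ y
p∪⁅x⁆≡p∪⁅y⁆⇒x≡y {p = p} {x} {y} x∉p eq with x ≟ᶠ y
... | yes x≡y = x≡y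
... | no x≢y =
  contradiction (x∈p∪⁅y⁆⇒x∈p (subst (x ∈_) eq (x∈p∪q⁺ (inj₂ (x∈⁅x⁆ x)))) x≢y) x∉p

x∉⊤-y⇒x≡y : ∀ {x y : Fin n} → x ∉ ⊤ - y → x ≡ y
x∉⊤-y⇒x≡y {x = x} {y} x∉ with x ≟ᶠ y
... | yes x≡y = x≡y
... | no x≢y = contradiction (x∈p∧x≢y⇒x∈p-y ∈⊤ x≢y) x∉

∣p∣≡1+∣p-x∣ : ∀ {p : Subset n} {x} → x ∈ p → ∣ p ∣ ≡ suc ∣ p - x ∣
∣p∣≡1+∣p-x∣ {p = inside ∷ p} {zero} _ = cong (suc ∘ ∣_∣) (sym (p─⊥≡p p))
∣p∣≡1+∣p-x∣ {p = inside ∷ p} {suc x} (there x∈p) = cong suc (∣p∣≡1+∣p-x∣ x∈p)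
∣p∣≡1+∣p-x∣ {p = outside ∷ p} {suc x} (there x∈p) = ∣p∣≡1+∣p-x∣ x∈p

∣p∪⁅x⁆∣≡1+∣p∣ : ∀ {p : Subset n} {x} → x ∉ p → ∣ p ∪ ⁅ x ⁆ ∣ ≡ suc ∣ p ∣
∣p∪⁅x⁆∣≡1+∣p∣ {p = p} {x} x∉p = trans (∣p∣≡1+∣p-x∣ {p = p ∪ ⁅ x ⁆} (x∈p∪q⁺ (inj₂ (x∈⁅x⁆ x))))
  (cong (suc ∘ ∣_∣) (p∪⁅x⁆-x≡p x∉p))

Empty⇒∣p∣≡0 : ∀ {p : Subset n} → Empty p → ∣ p ∣ ≡ 0
Empty⇒∣p∣≡0 {n} e = trans (cong ∣_∣ (Empty-unique e)) (∣⊥∣≡0 n)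

m<∣p∣⇒m≤∣p-x∣ : ∀ (p : Subset n) x → suc m ≤ ∣ p ∣ → m ≤ ∣ p - x ∣
m<∣p∣⇒m≤∣p-x∣ p x m<∣p∣ with x ∈? p
... | yes x∈p = s≤s⁻¹ (≤-trans m<∣p∣ (≤-reflexive (∣p∣≡1+∣p-x∣ x∈p)))
... | no x∉p = ≤-trans (<⇒≤ m<∣p∣)
  (p⊆q⇒∣p∣≤∣q∣ {p = p} {q = p - x} λ y∈p → x∈p∧x≢y⇒x∈p-y y∈p λ { refl → x∉p y∈p })

-- Greedy selection: deleting one entry of `xs` from `p` lowers the cardinality by at most one, so
-- an element survives all `m` deletions.
choose : ∀ (p : Subset n) (xs : Vec (Fin n) m) → m < ∣ p ∣ → ∃[ x ] x ∈ p × All (x ≢_) xs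
choose p [] 0<∣p∣ with nonempty? p
... | yes (x , x∈p) = x , x∈p , []
... | no empty = contradiction (subst (0 <_) (Empty⇒∣p∣≡0 {p = p} empty) 0<∣p∣) n≮0
choose p (y ∷ xs) m<∣p∣ with x , x∈p-y , x∉xs ← choose (p - y) xs (m<∣p∣⇒m≤∣p-x∣ p y m<∣p∣) =
  x , x∈p-y⇒x∈p x∈p-y , x∈p-y⇒x≢y x∈p-y ∷ x∉xs

fresh : ∀ (xs : Vec (Fin n) m) → m < n → ∃[ x ] All (x ≢_) xs
fresh {n} xs m<n =
  let x , _ , x∉xs = choose ⊤ xs (≤-trans m<n (≤-reflexive (sym (∣⊤∣≡n n)))) in x , x∉xs

unique⇒length≤ : ∀ {xs : Vec (Fin n) m} → Unique xs → m ≤ n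
unique⇒length≤ unique = injective⇒≤ (lookup-injective unique _ _)

OneOf : {A : Set} → A → A → A → Set
OneOf a b c = c ≡ a ⊎ c ≡ b

∣p∣≡2⇔pair : ∀ {p : Subset n} → ∣ p ∣ ≡ 2 ⇔
  (∃[ a ] ∃[ b ] a ≢ b × a ∈ p × b ∈ p × (∀ c → c ∈ p → OneOf a b c))
∣p∣≡2⇔pair {p = p} = mk⇔ to from
  where
  to : ∣ p ∣ ≡ 2 → _
  to eq
    with a , a∈p , _ ← choose p [] (≤-trans (s≤s z≤n) (≤-reflexive (sym eq)))
    with b , b∈p , b≢a ∷ [] ← choose p (a ∷ []) (≤-reflexive (sym eq))
    = a , b , ≢-sym b≢a , a∈p , b∈p , rest a∈p (x∈p∧x≢y⇒x∈p-y b∈p b≢a)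
    where
    rest : ∀ {a b} → a ∈ p → b ∈ p - a → ∀ c → c ∈ p → OneOf a b c
    rest {a} {b} a∈p b∈p-a c c∈p with c ≟ᶠ a | c ≟ᶠ b
    ... | yes c≡a | _ = inj₁ c≡a
    ... | no _ | yes c≡b = inj₂ c≡b
    -- A third element `c` makes `∣ p - a - b ∣` a successor, whereas counting gives zero.
    ... | no c≢a | no c≢b =
      case trans (sym (suc-injective (suc-injective
        (trans (sym (trans (∣p∣≡1+∣p-x∣ a∈p) (cong suc (∣p∣≡1+∣p-x∣ b∈p-a)))) eq))))
        (∣p∣≡1+∣p-x∣ (x∈p∧x≢y⇒x∈p-y (x∈p∧x≢y⇒x∈p-y c∈p c≢a) c≢b))
      of λ ()
  from : _ → ∣ p ∣ ≡ 2
  from (a , b , a≢b , a∈p , b∈p , rest) =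
    trans (∣p∣≡1+∣p-x∣ a∈p) (cong suc (trans
      (∣p∣≡1+∣p-x∣ {p = p - a} (x∈p∧x≢y⇒x∈p-y b∈p (≢-sym a≢b)))
      (cong suc (Empty⇒∣p∣≡0 {p = p - a - b} λ (c , c∈) →
        [ x∈p-y⇒x≢y (x∈p-y⇒x∈p {p = p - a} c∈) , x∈p-y⇒x≢y c∈ ]′
          (rest c (x∈p-y⇒x∈p (x∈p-y⇒x∈p {p = p - a} c∈)))))))

-- Graphs in which every vertex has exactly two neighbours

-- Degree two expressed without counting, so that it also applies to `D k G`, whose vertices are not
-- indexed by a `Fin`, and to `CodominatingPair`.
TwoValent : {V : Set} → Rel V 0ℓ → Set
TwoValent _~_ =
  ∀ v → ∃[ a ] ∃[ b ] a ≢ b × v ~ a × v ~ b × (∀ c → v ~ c → OneOf a b c)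

module _ {V : Set} (Adj : Rel V 0ℓ) (twoValent : TwoValent Adj) where

  no-three-neighbours : ∀ {v x y z} → x ≢ y → x ≢ z → y ≢ z →
                        Adj v x → Adj v y → ¬ Adj v z
  no-three-neighbours {v} x≢y x≢z y≢z vx vy vz with twoValent v
  ... | a , b , _ , _ , _ , only with only _ vx | only _ vy | only _ vz
  ... | inj₁ refl | inj₁ refl | _         = x≢y refl
  ... | inj₂ refl | inj₂ refl | _         = x≢y refl
  ... | inj₁ refl | inj₂ refl | inj₁ refl = x≢z refl
  ... | inj₂ refl | inj₁ refl | inj₂ refl = x≢z refl
  ... | inj₁ refl | inj₂ refl | inj₂ refl = y≢z refl
  ... | inj₂ refl | inj₁ refl | inj₁ refl = y≢z refl

  another-neighbour : ∀ {v u} → Adj v u → ∃[ w ] w ≢ u × Adj v w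
  another-neighbour {v} vu with twoValent v
  ... | a , b , a≢b , va , vb , only with only _ vu
  ... | inj₁ refl = b , ≢-sym a≢b , vb
  ... | inj₂ refl = a , a≢b , va

regular⇔twoValent : ∀ G → Regular G 2 ⇔ TwoValent (FiniteGraph.Adj G)
regular⇔twoValent G = mk⇔
  (λ reg v → let a , b , a≢b , va , vb , only = Equivalence.to ∣p∣≡2⇔pair (reg v)
             in a , b , a≢b , adj va , adj vb , λ c vc → only c (nbr vc))
  (λ tv v → let a , b , a≢b , va , vb , only = tv v
            in Equivalence.from ∣p∣≡2⇔pair
                 (a , b , a≢b , nbr va , nbr vb , λ c vc → only c (adj vc)))
  where
  open FiniteGraph G
  nbr : ∀ {v u} → Adj v u → u ∈ neighbours v
  nbr {v} {u} vu = lookup⇒[]= u _ (trans (lookup∘tabulate _ u) (dec-true (adj? v u) vu))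
  adj : ∀ {v u} → u ∈ neighbours v → Adj v u
  adj {v} {u} u∈ with adj? v u | trans (sym (lookup∘tabulate (does ∘ adj? v) u)) ([]=⇒lookup u∈)
  ... | yes vu | _ = vu
  ... | no _ | ()

-- Transport along graph isomorphisms

≅-sym : ∀ {G H} → G ≅ H → H ≅ G
≅-sym {G} {H} G≅H = record
  { bijection = ↔-sym bijection
  ; adjacency = λ u v → ⇔-sym (subst₂
      (λ x y → Graph.Adj G (from u) (from v) ⇔ Graph.Adj H x y)
      (strictlyInverseˡ u) (strictlyInverseˡ v) (adjacency (from u) (from v)))
  }
  where open _≅_ G≅H; open Inverse bijection using (from; strictlyInverseˡ)

≅-trans : ∀ {G H K} → G ≅ H → H ≅ K → G ≅ K
≅-trans G≅H H≅K = record
  { bijection = H≅K.bijection ↔-∘ G≅H.bijection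
  ; adjacency = λ u v → H≅K.adjacency _ _ ⇔-∘ G≅H.adjacency u v
  }
  where module G≅H = _≅_ G≅H; module H≅K = _≅_ H≅K

TwoValent-resp-≅ : ∀ {G H} → G ≅ H → TwoValent (Graph.Adj G) → TwoValent (Graph.Adj H)
TwoValent-resp-≅ {G} {H} G≅H tv v with tv (Inverse.from (_≅_.bijection G≅H) v)
... | a , b , a≢b , va , vb , only =
  to a , to b ,
  (λ eq → a≢b (trans (sym (strictlyInverseʳ a)) (trans (cong from eq) (strictlyInverseʳ b)))) ,
  push va , push vb ,
  λ c vc → [ inj₁ ∘ flip , inj₂ ∘ flip ]′ (only (from c) (pull vc))
  where
  open _≅_ G≅H
  open Inverse bijection using (to; from; strictlyInverseˡ; strictlyInverseʳ)
  push : ∀ {u} → Graph.Adj G (from v) u → Graph.Adj H v (to u)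
  push {u} = subst (λ x → Graph.Adj H x (to u)) (strictlyInverseˡ v) ∘
    Equivalence.to (adjacency (from v) u)
  pull : ∀ {c} → Graph.Adj H v c → Graph.Adj G (from v) (from c)
  pull {c} = Equivalence.from (adjacency (from v) (from c)) ∘
    subst₂ (Graph.Adj H) (sym (strictlyInverseˡ v)) (sym (strictlyInverseˡ c))
  flip : ∀ {c u} → from c ≡ u → c ≡ to u
  flip eq = trans (sym (strictlyInverseˡ _)) (cong to eq)

Connected-resp-≅ : ∀ {G H} → graph G ≅ graph H → Connected G → Connected H
Connected-resp-≅ {G} {H} G≅H connected u v =
  subst₂ (Star (FiniteGraph.Adj H)) (strictlyInverseˡ u) (strictlyInverseˡ v)
    (gmap to (λ {x} {y} → Equivalence.to (adjacency x y)) (connected (from u) (from v)))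
  where open _≅_ G≅H; open Inverse bijection using (to; from; strictlyInverseˡ)

connected⇒neighbour : ∀ G → Connected G → ∀ {u v} → u ≢ v → ∃[ w ] FiniteGraph.Adj G u w
connected⇒neighbour G connected {u} {v} u≢v with connected u v
... | ε = contradiction refl u≢v
... | uw ◅ _ = _ , uw

-- The k-dominating graph of G

-- Each change is undone by the opposite change of the same vertex, so the symmetric closure in `D`
-- adds no edges.
ObtainedByOneChange-sym : Symmetric (ObtainedByOneChange {n})
ObtainedByOneChange-sym (v , inj₁ (v∉S , refl)) =
  v , inj₂ (x∈p∪q⁺ (inj₂ (x∈⁅x⁆ v)) , sym (p∪⁅x⁆-x≡p v∉S))
ObtainedByOneChange-sym (v , inj₂ (v∈S , refl)) =
  v , inj₁ (x∉p-x _ v , sym (p-x∪⁅x⁆≡p v∈S))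

SymClosure⇒ObtainedByOneChange : ∀ {S T : Subset n} →
  SymClosure ObtainedByOneChange S T → ObtainedByOneChange S T
SymClosure⇒ObtainedByOneChange (fwd c) = c
SymClosure⇒ObtainedByOneChange (bwd c) = ObtainedByOneChange-sym c

obtainedByOneChange? : Decidable (ObtainedByOneChange {n})
obtainedByOneChange? S T = any? λ v →
  (¬? (v ∈? S) ×-dec T ≟ˢ S ∪ ⁅ v ⁆) ⊎-dec (v ∈? S ×-dec T ≟ˢ S - v)

module _ (H : FiniteGraph) where
  open FiniteGraph H

  -- Entry `i` of `L` is the set that represents vertex `i` of `H`. Every clause is a decidable
  -- finite check.
  Embeds : Vec (Subset n) order → Set
  Embeds L = (∀ i j → lookup L i ≡ lookup L j → i ≡ j) ×
             (∀ i j → (Adj i j → ObtainedByOneChange (lookup L i) (lookup L j)) ×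
                      (ObtainedByOneChange (lookup L i) (lookup L j) → Adj i j))

  embeds? : (L : Vec (Subset n) order) → Dec (Embeds L)
  embeds? L =
    (all? λ i → all? λ j → lookup L i ≟ˢ lookup L j →-dec i ≟ᶠ j) ×-dec
    (all? λ i → all? λ j →
      (adj? i j →-dec obtainedByOneChange? (lookup L i) (lookup L j)) ×-dec
      (obtainedByOneChange? (lookup L i) (lookup L j) →-dec adj? i j))

module _ (G : FiniteGraph) where
  open FiniteGraph G using (order; Adj; adj?; irrefl; Dominating)

  dominating? : ∀ S → Dec (Dominating S)
  dominating? S = all? λ v → ¬? (v ∈? S) →-dec any? λ u → u ∈? S ×-dec adj? v u

  Dominating-mono : ∀ {S T} → (∀ {x} → x ∈ S → x ∈ T) → Dominating S → Dominating T
  Dominating-mono S⊆T dom v v∉T with dom v (v∉T ∘ S⊆T)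
  ... | u , u∈S , vu = u , S⊆T u∈S , vu

  dominating-⊤-v : ∀ {v u} → Adj v u → Dominating (⊤ - v)
  dominating-⊤-v {v} {u} vu x x∉ with refl ← x∉⊤-y⇒x≡y x∉ =
    u , x∈p∧x≢y⇒x∈p-y ∈⊤ (λ { refl → irrefl _ vu }) , vu

  -- Only `v` and `u` need to be dominated: `x` serves `v` and `y` serves `u`.
  dominating-⊤-v-u : ∀ {v u x y} → Adj v x → x ≢ u → Adj u y → y ≢ v → Dominating (⊤ - v - u)
  dominating-⊤-v-u {v} {u} {x} {y} vx x≢u uy y≢v z z∉ with z ≟ᶠ v | z ≟ᶠ u
  ... | yes refl | _ =
    x , x∈p∧x≢y⇒x∈p-y (x∈p∧x≢y⇒x∈p-y ∈⊤ (λ { refl → irrefl _ vx })) x≢u , vx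
  ... | no _ | yes refl =
    y , x∈p∧x≢y⇒x∈p-y (x∈p∧x≢y⇒x∈p-y ∈⊤ y≢v) (λ { refl → irrefl _ uy }) , uy
  ... | no z≢v | no z≢u = contradiction (x∈p∧x≢y⇒x∈p-y (x∈p∧x≢y⇒x∈p-y ∈⊤ z≢v) z≢u) z∉

  module _ (k : ℕ) where

    Feasible : Subset order → Set
    Feasible S = Dominating S × ∣ S ∣ ≤ k

    feasible? : ∀ S → Dec (Feasible S)
    feasible? S = dominating? S ×-dec ∣ S ∣ ≤? k

    -- The proof stored in a vertex is irrelevant, but feasibility is decidable, so a usable proof
    -- can be recomputed.
    feasible : (v : Vertex (D k G)) → Feasible (value v)
    feasible (S ∶ [ f ]) = recompute (feasible? S) f

    vertex : ∀ S → Feasible S → Vertex (D k G)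
    vertex S f = S ∶ [ f ]

    -- The bijection sends a vertex to its position in `L`; positions are determined by the sets
    -- because the entries are distinct.
    D≅ : ∀ H {L} → Embeds H L → (∀ S → Feasible S ⇔ S ∈ᵛ L) → D k G ≅ graph H
    D≅ H {L} (distinct , edges) feasible⇔∈ = record
      { bijection = mk↔ₛ′ to from
          (λ i → distinct _ _ (sym (lookup-index (∈L (from i)))))
          (λ v → value-injective (sym (lookup-index (∈L v))))
      ; adjacency = λ u v → mk⇔
          (λ uv → proj₂ (edges _ _) (subst₂ ObtainedByOneChange
            (lookup-index (∈L u)) (lookup-index (∈L v)) (SymClosure⇒ObtainedByOneChange uv)))
          (λ uv → fwd (subst₂ ObtainedByOneChange
            (sym (lookup-index (∈L u))) (sym (lookup-index (∈L v))) (proj₁ (edges _ _) uv)))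
      }
      where
      ∈L : ∀ v → value v ∈ᵛ L
      ∈L v = Equivalence.to (feasible⇔∈ (value v)) (feasible v)
      to : Vertex (D k G) → Fin (FiniteGraph.order H)
      to v = index (∈L v)
      from : Fin (FiniteGraph.order H) → Vertex (D k G)
      from i = vertex (lookup L i) (Equivalence.from (feasible⇔∈ _) (∈-lookup i L))

  -- These pairs are the edges of the graph that `D k G` subdivides. `distinct` excludes loops:
  -- `⊤ - v - v` is just `⊤ - v`.
  record CodominatingPair (v u : Fin order) : Set where
    constructor codominating
    field
      distinct   : v ≢ u
      dominating : Dominating (⊤ - v - u)

  CodominatingPair-sym : Symmetric CodominatingPair
  CodominatingPair-sym {v} {u} (codominating v≢u dom) =
    codominating (≢-sym v≢u) (subst Dominating (p─x─y≡p─y─x ⊤ v u) dom)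

-- Two-valent k-dominating graphs

module _ (G : FiniteGraph) (connected : Connected G) {k : ℕ} (1≤k : 1 ≤ k)
         (twoValent : TwoValent (Graph.Adj (D k G))) (origin : Vertex (D k G)) where
  open FiniteGraph G using (order; Dominating)
  open Graph (D k G) using () renaming (Adj to Adjᴰ)

  one-change : ∀ {u v} → Adjᴰ u v → ObtainedByOneChange (value u) (value v)
  one-change = SymClosure⇒ObtainedByOneChange

  -- Take an edge at `origin`: its smaller end has one vertex fewer than the other end, which has at
  -- most `k`.
  feasible-below-k : ∃[ S ] Feasible G k S × ∣ S ∣ < k
  feasible-below-k with twoValent origin
  ... | a , _ , _ , origin-a , _ with one-change {origin} {a} origin-a
  ... | v , inj₁ (v∉S , eq) = value origin , feasible G k origin ,
    subst (_≤ k) (trans (cong ∣_∣ eq) (∣p∪⁅x⁆∣≡1+∣p∣ v∉S)) (proj₂ (feasible G k a))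
  ... | v , inj₂ (v∈S , eq) = value a , feasible G k a ,
    subst (_≤ k) (trans (∣p∣≡1+∣p-x∣ v∈S) (cong (suc ∘ ∣_∣) (sym eq)))
      (proj₂ (feasible G k origin))

  -- Supersets of `S` are dominating and there is room for one more vertex, so three vertices
  -- outside `S` would give three neighbours.
  order≤2+∣S∣ : ∀ {S} → Feasible G k S → ∣ S ∣ < k → order ≤ 2 + ∣ S ∣
  order≤2+∣S∣ {S} S-feasible ∣S∣<k with order ≤? 2 + ∣ S ∣
  ... | yes order≤ = order≤
  ... | no order≰
      with 3≤∣∁S∣ ← ≤-trans (m+n≤o⇒m≤o∸n 3 (≰⇒> order≰)) (≤-reflexive (sym (∣∁p∣≡n∸∣p∣ S)))
      with x , x∈ , _ ← choose (∁ S) [] (≤-trans (s≤s z≤n) 3≤∣∁S∣)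
      with y , y∈ , y≢x ∷ [] ← choose (∁ S) (x ∷ []) (≤-trans (s≤s (s≤s z≤n)) 3≤∣∁S∣)
      with z , z∈ , z≢x ∷ z≢y ∷ [] ← choose (∁ S) (x ∷ y ∷ []) 3≤∣∁S∣
      = ⊥-elim (no-three-neighbours Adjᴰ twoValent {vertex G k S S-feasible}
          (distinct x∈ y∈ (≢-sym y≢x)) (distinct x∈ z∈ (≢-sym z≢x)) (distinct y∈ z∈ (≢-sym z≢y))
          (below-above x∈) (below-above y∈) (below-above z∈))
    where
    above : ∀ {w} → w ∈ ∁ S → Vertex (D k G)
    above {w} w∈ = vertex G k (S ∪ ⁅ w ⁆)
      ( Dominating-mono G (x∈p∪q⁺ ∘ inj₁) (proj₁ S-feasible)
      , ≤-trans (≤-reflexive (∣p∪⁅x⁆∣≡1+∣p∣ {p = S} (x∈∁p⇒x∉p w∈))) ∣S∣<k)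
    distinct : ∀ {x y} (x∈ : x ∈ ∁ S) (y∈ : y ∈ ∁ S) → x ≢ y → above x∈ ≢ above y∈
    distinct x∈ _ x≢y = x≢y ∘ p∪⁅x⁆≡p∪⁅y⁆⇒x≡y (x∈∁p⇒x∉p x∈) ∘ cong value
    below-above : ∀ {x} (x∈ : x ∈ ∁ S) → Adjᴰ (vertex G k S S-feasible) (above x∈)
    below-above {x} x∈ = fwd (x , inj₁ (x∈∁p⇒x∉p x∈ , refl))

  -- A second vertex and connectedness provide a neighbour of `v`, which dominates it.
  dominating-⊤-x : ∀ {v w} → w ≢ v → Dominating (⊤ - v)
  dominating-⊤-x w≢v =
    dominating-⊤-v G (proj₂ (connected⇒neighbour G connected (≢-sym w≢v)))

  -- If ⊤ were feasible, it would have a neighbour ⊤ - a, which has a neighbour ⊤ - a - c;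
  -- a vertex u of the latter dominates a, and ⊤ - a, ⊤ - c, ⊤ - u are all adjacent to ⊤.
  k<order : k < order
  k<order with suc k ≤? order
  ... | yes k<order = k<order
  ... | no k≮order = ⊥-elim absurd
    where
    order≤k : order ≤ k
    order≤k = s≤s⁻¹ (≰⇒> k≮order)

    full : Vertex (D k G)
    full = vertex G k ⊤ ((λ _ v∉⊤ → contradiction ∈⊤ v∉⊤) , ≤-trans (∣p∣≤n ⊤) order≤k)

    below-full : ∀ {T} → Adjᴰ full T → ∃[ a ] value T ≡ ⊤ - a
    below-full {T} adj with one-change {full} {T} adj
    ... | v , inj₁ (v∉⊤ , _) = contradiction ∈⊤ v∉⊤
    ... | v , inj₂ (_ , eq) = v , eq

    absurd : ⊥
    absurd
      with A , B , A≢B , fullA , fullB , _ ← twoValent full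
      with a , A≡ ← below-full {A} fullA | b , B≡ ← below-full {B} fullB
      = step (another-neighbour Adjᴰ twoValent {A} {full} (swap′ fullA))
      where
      swap′ : Adjᴰ full A → Adjᴰ A full
      swap′ = Graph.symm (D k G) {full} {A}
      a≢b : a ≢ b
      a≢b refl = A≢B (value-injective (trans A≡ (sym B≡)))
      dominating : ∀ v → Dominating (⊤ - v)
      -- At least one of the distinct vertices `a` and `b` differs from `v`.
      dominating v with a ≟ᶠ v
      ... | yes refl = dominating-⊤-x (≢-sym a≢b)
      ... | no a≢v = dominating-⊤-x a≢v
      corner : ∀ v → Vertex (D k G)
      corner v = vertex G k (⊤ - v) (dominating v , ≤-trans (∣p∣≤n (⊤ - v)) order≤k)
      full-corner : ∀ v → Adjᴰ full (corner v)
      full-corner v = fwd (v , inj₂ (∈⊤ , refl))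
      corner-injective : ∀ {v u} → corner v ≡ corner u → v ≡ u
      corner-injective = p-x≡p-y⇒x≡y {p = ⊤} ∈⊤ ∘ cong value
      step : ∃[ W ] W ≢ full × Adjᴰ A W → ⊥
      step (W , W≢full , AW) with one-change {A} {W} AW
      -- The only vertex that can be added to `⊤ - a` is `a`, which leads back to `full`.
      ... | c , inj₁ (c∉A , W≡) with refl ← x∉⊤-y⇒x≡y (subst (c ∉_) A≡ c∉A) =
        W≢full (value-injective (trans W≡
          (trans (cong (_∪ ⁅ c ⁆) A≡) (p-x∪⁅x⁆≡p {p = ⊤} ∈⊤))))
      ... | c , inj₂ (c∈A , W≡) =
        let W≡⊤-a-c = trans W≡ (cong (_- c) A≡)
            u , u∈ , _ = subst Dominating W≡⊤-a-c (proj₁ (feasible G k W)) a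
                           λ a∈ → x∉p-x ⊤ a (x∈p-y⇒x∈p {p = ⊤ - a} a∈)
            c≢a = x∈p-y⇒x≢y {p = ⊤} (subst (c ∈_) A≡ c∈A)
            u≢a = x∈p-y⇒x≢y {p = ⊤} (x∈p-y⇒x∈p {p = ⊤ - a} u∈)
            u≢c = x∈p-y⇒x≢y {p = ⊤ - a} u∈
        in no-three-neighbours Adjᴰ twoValent {full} {corner a} {corner c} {corner u}
             (c≢a ∘ sym ∘ corner-injective) (u≢a ∘ sym ∘ corner-injective)
             (u≢c ∘ sym ∘ corner-injective) (full-corner a) (full-corner c) (full-corner u)

  -- For `S` of size below `k`, `k < order ≤ 2 + ∣ S ∣ ≤ 1 + k`.
  1+k≡order : suc k ≡ order
  1+k≡order with S , S-feasible , ∣S∣<k ← feasible-below-k =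
    ≤-antisym k<order (≤-trans (order≤2+∣S∣ S-feasible ∣S∣<k) (s≤s ∣S∣<k))

  ⊤-v-feasible : ∀ v → Feasible G k (⊤ - v)
  ⊤-v-feasible v = dominating , s≤s⁻¹ (≤-reflexive size)
    where
    size : suc ∣ ⊤ - v ∣ ≡ suc k
    size = trans (sym (∣p∣≡1+∣p-x∣ {p = ⊤} {v} ∈⊤)) (trans (∣⊤∣≡n order) (sym 1+k≡order))
    dominating : Dominating (⊤ - v)
    -- Since `1 ≤ k`, the order `1 + k` is at least two, so `v` is not the only vertex.
    dominating with w , w≢v ∷ [] ← fresh (v ∷ []) (subst (1 <_) 1+k≡order (s≤s 1≤k)) =
      dominating-⊤-x w≢v

  corner : Fin order → Vertex (D k G)
  corner v = vertex G k (⊤ - v) (⊤-v-feasible v)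

  corner-neighbour : ∀ {v T} → Adjᴰ (corner v) T → ∃[ u ] v ≢ u × value T ≡ ⊤ - v - u
  corner-neighbour {v} {T} vT with one-change {corner v} {T} vT
  ... | u , inj₂ (u∈ , T≡) = u , ≢-sym (x∈p-y⇒x≢y u∈) , T≡
  -- Adding a vertex would restore `⊤`, whose size `1 + k` exceeds the bound.
  ... | u , inj₁ (u∉ , T≡) with refl ← x∉⊤-y⇒x≡y u∉ = contradiction
    (≤-trans (≤-reflexive (trans 1+k≡order (sym (trans (cong ∣_∣ T≡⊤) (∣⊤∣≡n order)))))
      (proj₂ (feasible G k T)))
    (n≮n k)
    where
    T≡⊤ : value T ≡ ⊤
    T≡⊤ = trans T≡ (p-x∪⁅x⁆≡p {p = ⊤} ∈⊤)

  -- The partners `u` of `v` correspond to the neighbours `⊤ - v - u` of `corner v`, so two-valence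
  -- carries over.
  codominating-twoValent : TwoValent (CodominatingPair G)
  codominating-twoValent v
    with A , B , A≢B , vA , vB , only ← twoValent (corner v)
    with a , v≢a , A≡ ← corner-neighbour {v} {A} vA
    with b , v≢b , B≡ ← corner-neighbour {v} {B} vB
    = a , b , (λ { refl → A≢B (value-injective (trans A≡ (sym B≡))) })
    , codominating v≢a (subst Dominating A≡ (proj₁ (feasible G k A)))
    , codominating v≢b (subst Dominating B≡ (proj₁ (feasible G k B)))
    , only′
    where
    only′ : ∀ c → CodominatingPair G v c → OneOf a b c
    only′ c (codominating v≢c dom) = [ inj₁ ∘ same A≡ , inj₂ ∘ same B≡ ]′
      (only edge (fwd (c , inj₂ (c∈⊤-v , refl))))
      where
      c∈⊤-v : c ∈ ⊤ - v
      c∈⊤-v = x∈p∧x≢y⇒x∈p-y ∈⊤ (≢-sym v≢c)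
      edge : Vertex (D k G)
      edge = vertex G k (⊤ - v - c)
        (dom , ≤-trans (∣p─q∣≤∣p∣ (⊤ - v) ⁅ c ⁆) (proj₂ (⊤-v-feasible v)))
      same : ∀ {T x} → value T ≡ ⊤ - v - x → edge ≡ T → c ≡ x
      same T≡ refl = p-x≡p-y⇒x≡y c∈⊤-v T≡

-- The graph of pairs with dominating complement has order three or four

3≤order : ∀ G → TwoValent (CodominatingPair G) → Fin (FiniteGraph.order G) →
          3 ≤ FiniteGraph.order G
3≤order G twoValent v with a , b , a≢b , va , vb , _ ← twoValent v = unique⇒length≤
  ((CodominatingPair.distinct va ∷ CodominatingPair.distinct vb ∷ []) ∷ (a≢b ∷ []) ∷ [] ∷ [])

module _ (G : FiniteGraph) (connected : Connected G)
         (twoValent : TwoValent (CodominatingPair G)) where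
  open FiniteGraph G using (order; Adj; adj?)

  -- Adjacency in the complement of the graph of codominating pairs.
  Spoiled : Fin order → Fin order → Set
  Spoiled v c = v ≢ c × ¬ CodominatingPair G v c

  -- If `v` and `c` are not adjacent, the neighbour that each has by connectedness differs from the
  -- other vertex, so removing both leaves a dominating set.
  spoiled⇒adjacent : ∀ {v c} → Spoiled v c → Adj v c
  spoiled⇒adjacent {v} {c} (v≢c , ¬pair) with adj? v c
  ... | yes vc = vc
  ... | no ¬vc =
    let u , vu = connected⇒neighbour G connected v≢c
        w , cw = connected⇒neighbour G connected (≢-sym v≢c)
    in contradiction
         (codominating v≢c (dominating-⊤-v-u G
           vu (λ u≡c → ¬vc (subst (Adj v) u≡c vu))
           cw (λ w≡v → ¬vc (FiniteGraph.symm G (subst (Adj c) w≡v cw)))))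
         ¬pair

  -- Spoiled pairs are edges, so `d` dominates `v` once `c` is removed. If `e` differed from `v`, it
  -- would dominate `c`, and the pair `v`, `c` would be codominating.
  spoiled-degree≤1 : ∀ {v c d e} → Spoiled v c → Spoiled v d → c ≢ d → Spoiled c e → e ≡ v
  spoiled-degree≤1 {v} {c} {d} {e} (v≢c , ¬pair) vd c≢d ce with e ≟ᶠ v
  ... | yes e≡v = e≡v
  ... | no e≢v = contradiction
    (codominating v≢c (dominating-⊤-v-u G
      (spoiled⇒adjacent vd) (≢-sym c≢d) (spoiled⇒adjacent ce) e≢v))
    ¬pair

  -- Besides `v` and its two partners, at least two vertices remain.
  two-spoiled : 5 ≤ order → ∀ v → ∃[ c ] ∃[ d ] c ≢ d × Spoiled v c × Spoiled v d
  two-spoiled 5≤order v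
    with a , b , _ , _ , _ , only ← twoValent v
    with c , c≢v ∷ c≢a ∷ c≢b ∷ [] ← fresh (v ∷ a ∷ b ∷ []) (<⇒≤ 5≤order)
    with d , d≢v ∷ d≢a ∷ d≢b ∷ d≢c ∷ [] ← fresh (v ∷ a ∷ b ∷ c ∷ []) 5≤order
    = c , d , ≢-sym d≢c
    , (≢-sym c≢v , [ c≢a , c≢b ]′ ∘ only c)
    , (≢-sym d≢v , [ d≢a , d≢b ]′ ∘ only d)

  order<5 : Fin order → order < 5
  order<5 v with 5 ≤? order
  ... | no 5≰order = ≰⇒> 5≰order
  ... | yes 5≤order =
    -- As `v` has two spoiled partners, `v` is the only one of `c`; yet `c` has two as well, `e` and
    -- `f`.
    let c , d , c≢d , vc , vd = two-spoiled 5≤order v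
        e , f , e≢f , ce , cf = two-spoiled 5≤order c
    in contradiction
         (trans (spoiled-degree≤1 vc vd c≢d ce) (sym (spoiled-degree≤1 vc vd c≢d cf))) e≢f

-- Two-valent graphs on three and four vertices

record Triangle (_~_ : Rel (Fin 3) 0ℓ) : Set where
  field
    x y z  : Fin 3
    unique : Unique (x ∷ y ∷ z ∷ [])
    xy     : x ~ y
    yz     : y ~ z
    zx     : z ~ x

-- The diagonals must be non-edges: their complements have the size of an edge set but are absent
-- from the octagon.
record Quadrilateral (_~_ : Rel (Fin 4) 0ℓ) : Set where
  field
    w x y z : Fin 4
    unique  : Unique (w ∷ x ∷ y ∷ z ∷ [])
    wx      : w ~ x
    xy      : x ~ y
    yz      : y ~ z
    zw      : z ~ w
    w≢y     : w ≢ y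
    ¬wy     : ¬ w ~ y
    x≢z     : x ≢ z
    ¬xz     : ¬ x ~ z

-- The second neighbour of `a` must be `b`, as otherwise there would be four distinct vertices.
triangle : {_~_ : Rel (Fin 3) 0ℓ} → Symmetric _~_ → (∀ {u v} → u ~ v → u ≢ v) →
           TwoValent _~_ → Triangle _~_
triangle {_~_} ~-sym ~⇒≢ twoValent
  with a , b , a≢b , 0a , 0b , _ ← twoValent 0F
  with w , w≢0 , aw ← another-neighbour _~_ twoValent (~-sym 0a)
  = record { unique = unique ; xy = 0a ; yz = ab ; zx = ~-sym 0b }
  where
  unique : Unique (0F ∷ a ∷ b ∷ [])
  unique = (~⇒≢ 0a ∷ ~⇒≢ 0b ∷ []) ∷ (a≢b ∷ []) ∷ [] ∷ []
  ab : a ~ b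
  ab with w ≟ᶠ b
  ... | yes refl = aw
  ... | no w≢b = contradiction
    (unique⇒length≤ ((w≢0 ∷ ≢-sym (~⇒≢ aw) ∷ w≢b ∷ []) ∷ unique)) (n≮n 3)

-- The vertex `c` outside `0F`, `a`, `b` is not adjacent to `0F`, so its neighbours are `a` and `b`.
-- Then `0F` and `c` exhaust the neighbours of `a`, which excludes the diagonal `a`, `b`.
quadrilateral : {_~_ : Rel (Fin 4) 0ℓ} → Symmetric _~_ → (∀ {u v} → u ~ v → u ≢ v) →
                TwoValent _~_ → Quadrilateral _~_
quadrilateral {_~_} ~-sym ~⇒≢ twoValent
  with a , b , a≢b , 0a , 0b , only₀ ← twoValent 0F
  with c , c≢0 ∷ c≢a ∷ c≢b ∷ [] ← fresh (0F ∷ a ∷ b ∷ []) ≤-refl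
  = record
    { unique = unique ; wx = 0a ; xy = ~-sym ca ; yz = cb ; zw = ~-sym 0b
    ; w≢y = ≢-sym c≢0 ; ¬wy = ¬0c ; x≢z = a≢b
    ; ¬xz = no-three-neighbours _~_ twoValent (≢-sym c≢0) (~⇒≢ 0b) c≢b (~-sym 0a) (~-sym ca)
    }
  where
  unique : Unique (0F ∷ a ∷ c ∷ b ∷ [])
  unique = (~⇒≢ 0a ∷ ≢-sym c≢0 ∷ ~⇒≢ 0b ∷ []) ∷ (≢-sym c≢a ∷ a≢b ∷ []) ∷ (c≢b ∷ []) ∷ [] ∷ []
  ¬0c : ¬ 0F ~ c
  ¬0c 0c = [ c≢a , c≢b ]′ (only₀ c 0c)
  neighbour-of-c : ∀ {w} → c ~ w → OneOf a b w
  neighbour-of-c {w} cw with w ≟ᶠ a | w ≟ᶠ b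
  ... | yes w≡a | _ = inj₁ w≡a
  ... | no _ | yes w≡b = inj₂ w≡b
  ... | no w≢a | no w≢b = contradiction
    (unique⇒length≤ ((w≢0 ∷ w≢a ∷ ≢-sym (~⇒≢ cw) ∷ w≢b ∷ []) ∷ unique)) (n≮n 4)
    where
    w≢0 : w ≢ 0F
    w≢0 refl = ¬0c (~-sym cw)
  ca,cb : c ~ a × c ~ b
  ca,cb with u , w , u≢w , cu , cw , _ ← twoValent c
        with neighbour-of-c cu | neighbour-of-c cw
  ... | inj₁ refl | inj₂ refl = cu , cw
  ... | inj₂ refl | inj₁ refl = cw , cu
  ... | inj₁ refl | inj₁ refl = contradiction refl u≢w
  ... | inj₂ refl | inj₂ refl = contradiction refl u≢w
  ca : c ~ a
  ca = proj₁ ca,cb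
  cb : c ~ b
  cb = proj₂ ca,cb

-- Triangles and quadrilaterals, subdivided in the k-dominating graph

-- Corners and edge sets alternate in cyclic order, so positions match the vertices of `C 6`.
hexagon : Fin n → Fin n → Fin n → Vec (Subset n) 6
hexagon x y z =
  (⊤ - x) ∷ (⊤ - x - y) ∷ (⊤ - y) ∷ (⊤ - y - z) ∷ (⊤ - z) ∷ (⊤ - z - x) ∷ []

octagon : Fin n → Fin n → Fin n → Fin n → Vec (Subset n) 8
octagon w x y z =
  (⊤ - w) ∷ (⊤ - w - x) ∷ (⊤ - x) ∷ (⊤ - x - y) ∷
  (⊤ - y) ∷ (⊤ - y - z) ∷ (⊤ - z) ∷ (⊤ - z - w) ∷ []

unique? : (xs : Vec (Fin n) m) → Dec (Unique xs)
unique? = allPairs? λ x y → ¬? (x ≟ᶠ y)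

hexagon-embeds : ∀ (x y z : Fin 3) → Unique (x ∷ y ∷ z ∷ []) → Embeds (C 6) (hexagon x y z)
hexagon-embeds = from-yes (all? λ (x : Fin 3) → all? λ (y : Fin 3) → all? λ (z : Fin 3) →
  unique? (x ∷ y ∷ z ∷ []) →-dec embeds? (C 6) (hexagon x y z))

-- The three subsets of size 2 and the three of size 1 are all listed.
hexagon-covers : ∀ (x y z : Fin 3) → Unique (x ∷ y ∷ z ∷ []) →
                 ∀ S → S ∈ᵛ hexagon x y z ⊎ ∣ S ∣ < 1 ⊎ 2 < ∣ S ∣
hexagon-covers = from-yes (all? λ (x : Fin 3) → all? λ (y : Fin 3) → all? λ (z : Fin 3) →
  unique? (x ∷ y ∷ z ∷ []) →-dec
  allSubsets? λ S → S ∈ᵛ? hexagon x y z ⊎-dec ∣ S ∣ <? 1 ⊎-dec 2 <? ∣ S ∣)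

octagon-embeds : ∀ (w x y z : Fin 4) → Unique (w ∷ x ∷ y ∷ z ∷ []) →
                 Embeds (C 8) (octagon w x y z)
octagon-embeds = from-yes (
  all? λ (w : Fin 4) → all? λ (x : Fin 4) → all? λ (y : Fin 4) → all? λ (z : Fin 4) →
  unique? (w ∷ x ∷ y ∷ z ∷ []) →-dec embeds? (C 8) (octagon w x y z))

-- There are four subsets of size 3 and six of size 2; the octagon lists all but the complements of
-- the two diagonals.
octagon-covers : ∀ (w x y z : Fin 4) → Unique (w ∷ x ∷ y ∷ z ∷ []) →
                 ∀ S → S ∈ᵛ octagon w x y z ⊎ ∣ S ∣ < 2 ⊎ 3 < ∣ S ∣ ⊎
                       S ≡ ⊤ - w - y ⊎ S ≡ ⊤ - x - z
octagon-covers = from-yes (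
  all? λ (w : Fin 4) → all? λ (x : Fin 4) → all? λ (y : Fin 4) → all? λ (z : Fin 4) →
  unique? (w ∷ x ∷ y ∷ z ∷ []) →-dec
  allSubsets? λ S → S ∈ᵛ? octagon w x y z ⊎-dec ∣ S ∣ <? 2 ⊎-dec 3 <? ∣ S ∣ ⊎-dec
                    S ≟ˢ ⊤ - w - y ⊎-dec S ≟ˢ ⊤ - x - z)

CornersFeasible : FiniteGraph → ℕ → Set
CornersFeasible G k = ∀ v → Feasible G k (⊤ - v)

SmallSetsCoverAllButTwo : FiniteGraph → ℕ → Set
SmallSetsCoverAllButTwo G k = ∀ S → Feasible G k S → ∣ S ∣ < k → FiniteGraph.order G ≤ 2 + ∣ S ∣

edge-feasible : ∀ G {k} → CornersFeasible G k → ∀ {v u} → CodominatingPair G v u →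
                Feasible G k (⊤ - v - u)
edge-feasible G corners {v} {u} pair =
  CodominatingPair.dominating pair , ≤-trans (∣p─q∣≤∣p∣ (⊤ - v) ⁅ u ⁆) (proj₂ (corners v))

D≅C₆ : ∀ G → FiniteGraph.order G ≡ 3 → CornersFeasible G 2 → SmallSetsCoverAllButTwo G 2 →
       TwoValent (CodominatingPair G) → D 2 G ≅ graph (C 6)
-- Matching on the record makes its order a variable, which `refl` then sets to 3, so the tables
-- over `Fin 3` apply.
D≅C₆ G@(record { order = _ }) refl corners small twoValent =
  D≅ G 2 (C 6) (hexagon-embeds x y z unique)
    (λ S → mk⇔ (λ f → [ (λ S∈ → S∈) , [ ⊥-elim ∘ too-small S f , ⊥-elim ∘ too-large S f ]′ ]′
                        (hexagon-covers x y z unique S))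
               (All-lookup hexagon-feasible))
  where
  open Triangle (triangle (CodominatingPair-sym G) CodominatingPair.distinct twoValent)
  hexagon-feasible : All (Feasible G 2) (hexagon x y z)
  hexagon-feasible =
    corners x ∷ edge-feasible G corners xy ∷ corners y ∷ edge-feasible G corners yz ∷
    corners z ∷ edge-feasible G corners zx ∷ []
  too-small : ∀ S → Feasible G 2 S → ¬ ∣ S ∣ < 1
  -- For the empty set, `small` would give `3 ≤ 2`.
  too-small S f ∣S∣<1 =
    <⇒≱ (s≤s (s≤s ∣S∣<1)) (small S f (≤-trans ∣S∣<1 (s≤s z≤n)))
  too-large : ∀ S → Feasible G 2 S → ¬ 2 < ∣ S ∣
  too-large S f 2<∣S∣ = <⇒≱ 2<∣S∣ (proj₂ f)

D≅C₈ : ∀ G → FiniteGraph.order G ≡ 4 → CornersFeasible G 3 → SmallSetsCoverAllButTwo G 3 →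
       TwoValent (CodominatingPair G) → D 3 G ≅ graph (C 8)
D≅C₈ G@(record { order = _ }) refl corners small twoValent =
  D≅ G 3 (C 8) (octagon-embeds w x y z unique)
    (λ S → mk⇔ (λ f → [ (λ S∈ → S∈) , [ ⊥-elim ∘ too-small S f , [ ⊥-elim ∘ too-large S f ,
                        [ ⊥-elim ∘ diagonal S f w≢y ¬wy , ⊥-elim ∘ diagonal S f x≢z ¬xz ]′ ]′ ]′ ]′
                        (octagon-covers w x y z unique S))
               (All-lookup octagon-feasible))
  where
  open Quadrilateral (quadrilateral (CodominatingPair-sym G) CodominatingPair.distinct twoValent)
  octagon-feasible : All (Feasible G 3) (octagon w x y z)
  octagon-feasible =
    corners w ∷ edge-feasible G corners wx ∷ corners x ∷ edge-feasible G corners xy ∷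
    corners y ∷ edge-feasible G corners yz ∷ corners z ∷ edge-feasible G corners zw ∷ []
  too-small : ∀ S → Feasible G 3 S → ¬ ∣ S ∣ < 2
  too-small S f ∣S∣<2 =
    <⇒≱ (s≤s (s≤s ∣S∣<2)) (small S f (≤-trans ∣S∣<2 (s≤s (s≤s z≤n))))
  too-large : ∀ S → Feasible G 3 S → ¬ 3 < ∣ S ∣
  too-large S f 3<∣S∣ = <⇒≱ 3<∣S∣ (proj₂ f)
  diagonal : ∀ S → Feasible G 3 S → ∀ {u v} → u ≢ v → ¬ CodominatingPair G u v →
             S ≢ ⊤ - u - v
  diagonal S f u≢v ¬uv S≡ =
    ¬uv (codominating u≢v (subst (FiniteGraph.Dominating G) S≡ (proj₁ f)))

twoValent-D⇒C₆⊎C₈ : ∀ G {k} → Connected G → 1 ≤ k → TwoValent (Graph.Adj (D k G)) →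
                    Vertex (D k G) → D k G ≅ graph (C 6) ⊎ D k G ≅ graph (C 8)
twoValent-D⇒C₆⊎C₈ G {k} connected 1≤k twoValent origin = go k _ refl 1+k≡n refl
  where
  1+k≡n = 1+k≡order G connected 1≤k twoValent origin
  pairs = codominating-twoValent G connected 1≤k twoValent origin
  n<5 = order<5 G connected pairs (subst Fin 1+k≡n zero)
  corners = ⊤-v-feasible G connected 1≤k twoValent origin
  small : SmallSetsCoverAllButTwo G k
  small S = order≤2+∣S∣ G connected 1≤k twoValent origin {S}
  -- Fresh variables with equations allow matching on numerals. The value 0 violates `1 ≤ k`, 1
  -- violates `3≤order`, and 4 or more violates `order<5`.
  go : ∀ k′ n → suc k′ ≡ n → n ≡ FiniteGraph.order G → k′ ≡ k →
       D k G ≅ graph (C 6) ⊎ D k G ≅ graph (C 8)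
  go 0 _ _ _ refl = contradiction 1≤k n≮0
  go 1 _ refl 2≡order _ =
    contradiction (subst (3 ≤_) (sym 2≡order) (3≤order G pairs (subst Fin 1+k≡n zero)))
      (<⇒≱ ≤-refl)
  go 2 _ refl 3≡order refl = inj₁ (D≅C₆ G (sym 3≡order) corners small pairs)
  go 3 _ refl 4≡order refl = inj₂ (D≅C₈ G (sym 4≡order) corners small pairs)
  go (suc (suc (suc (suc _)))) _ refl n≡order _ =
    contradiction (subst (_< 5) (sym n≡order) n<5) (<⇒≱ (m≤m+n 6 _))

-- The hexagon and the octagon are realised by C 3 and by the path on four vertices

P₄ : FiniteGraph
P₄ = record
  { order    = 4
  ; nonEmpty = _
  ; Adj      = λ i j → toℕ j ≡ suc (toℕ i) ⊎ toℕ i ≡ suc (toℕ j)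
  ; adj?     = λ i j → toℕ j ≟ suc (toℕ i) ⊎-dec toℕ i ≟ suc (toℕ j)
  ; symm     = swap
  ; irrefl   = λ i → [ n≢1+n , n≢1+n ]′
  }
  where
  n≢1+n : ∀ {i} → i ≢ suc i
  n≢1+n = ≢-sym 1+n≢n

-- Two vertices are joined through `zero`, which reaches each of them along consecutive indices.
consecutive-adjacent⇒connected : {R : Rel (Fin (suc n)) 0ℓ} → Symmetric R →
  (∀ i → R (inject₁ i) (suc i)) → ∀ u v → Star R u v
consecutive-adjacent⇒connected {R = R} R-sym step u v =
  reverse R-sym (from-zero u) ◅◅ from-zero v
  where
  from-zero : ∀ v → Star R zero v
  from-zero = <-weakInduction (Star R zero) ε λ i path → path ◅◅ step i ◅ ε

D₂C₃≅C₆ : D 2 (C 3) ≅ graph (C 6)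
D₂C₃≅C₆ = D≅ (C 3) 2 (C 6) (hexagon-embeds 0F 1F 2F (from-yes (unique? (0F ∷ 1F ∷ 2F ∷ []))))
  λ S → mk⇔ (proj₁ (feasible⇔∈ S)) (proj₂ (feasible⇔∈ S))
  where
  feasible⇔∈ : ∀ S → (Feasible (C 3) 2 S → S ∈ᵛ hexagon 0F 1F 2F) ×
                     (S ∈ᵛ hexagon 0F 1F 2F → Feasible (C 3) 2 S)
  feasible⇔∈ = from-yes (allSubsets? λ S →
    (feasible? (C 3) 2 S →-dec S ∈ᵛ? hexagon 0F 1F 2F) ×-dec
    (S ∈ᵛ? hexagon 0F 1F 2F →-dec feasible? (C 3) 2 S))

-- The leaf edges of P₄ are 01 and 23; the other four pairs form the quadrilateral 0 2 1 3.
D₃P₄≅C₈ : D 3 P₄ ≅ graph (C 8)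
D₃P₄≅C₈ = D≅ P₄ 3 (C 8)
  (octagon-embeds 0F 2F 1F 3F (from-yes (unique? (0F ∷ 2F ∷ 1F ∷ 3F ∷ []))))
  λ S → mk⇔ (proj₁ (feasible⇔∈ S)) (proj₂ (feasible⇔∈ S))
  where
  feasible⇔∈ : ∀ S → (Feasible P₄ 3 S → S ∈ᵛ octagon 0F 2F 1F 3F) ×
                     (S ∈ᵛ octagon 0F 2F 1F 3F → Feasible P₄ 3 S)
  feasible⇔∈ = from-yes (allSubsets? λ S →
    (feasible? P₄ 3 S →-dec S ∈ᵛ? octagon 0F 2F 1F 3F) ×-dec
    (S ∈ᵛ? octagon 0F 2F 1F 3F →-dec feasible? P₄ 3 S))

-- For a concrete graph the `True` argument evaluates to the unit type, so `_` fills it.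
connected-by-computation : ∀ G {n} (order≡ : FiniteGraph.order G ≡ suc n) →
  True (all? λ i → FiniteGraph.adj? G (subst Fin (sym order≡) (inject₁ i))
                                      (subst Fin (sym order≡) (suc i))) →
  Connected G
connected-by-computation G@(record { order = _ }) refl adjacent =
  consecutive-adjacent⇒connected (FiniteGraph.symm G) (toWitness adjacent)

-- The two directions of the classification

𝓓₂-intro : ∀ {H K} G {k} → graph H ≅ graph K → D k G ≅ graph K → Regular K 2 →
           Connected K → Connected G → 1 ≤ k → 𝓓₂ H
𝓓₂-intro {H} {K} G {k} H≅K D≅K regular K-connected G-connected 1≤k =
  Equivalence.from (regular⇔twoValent H)
    (TwoValent-resp-≅ K≅H (Equivalence.to (regular⇔twoValent K) regular)) ,
  Connected-resp-≅ {K} {H} K≅H K-connected ,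
  G , G-connected , k , 1≤k , ≅-trans H≅K (≅-sym D≅K)
  where
  K≅H = ≅-sym H≅K

corollary4p2 : (H : FiniteGraph) → 𝓓₂ H ⇔ (graph H ≅ graph (C 6) ⊎ graph H ≅ graph (C 8))
corollary4p2 H = mk⇔ to from
  where
  to : 𝓓₂ H → graph H ≅ graph (C 6) ⊎ graph H ≅ graph (C 8)
  to (regular , _ , G , connected , k , 1≤k , H≅D) =
    [ inj₁ ∘ ≅-trans H≅D , inj₂ ∘ ≅-trans H≅D ]′
      (twoValent-D⇒C₆⊎C₈ G connected 1≤k
        (TwoValent-resp-≅ H≅D (Equivalence.to (regular⇔twoValent H) regular))
        (Inverse.to (_≅_.bijection H≅D) (vertex-of H)))
    where
    vertex-of : ∀ H → Vertex (graph H)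
    -- `nonEmpty` rules out order zero; the image of this vertex serves as `origin` in `D k G`.
    vertex-of record { order = suc _ } = zero
  from : graph H ≅ graph (C 6) ⊎ graph H ≅ graph (C 8) → 𝓓₂ H
  from (inj₁ H≅C₆) = 𝓓₂-intro {H} {C 6} (C 3) H≅C₆ D₂C₃≅C₆
    (from-yes (all? λ v → FiniteGraph.degree (C 6) v ≟ 2))
    (connected-by-computation (C 6) refl _) (connected-by-computation (C 3) refl _) (s≤s z≤n)
  from (inj₂ H≅C₈) = 𝓓₂-intro {H} {C 8} P₄ H≅C₈ D₃P₄≅C₈
    (from-yes (all? λ v → FiniteGraph.degree (C 8) v ≟ 2))
    (connected-by-computation (C 8) refl _) (connected-by-computation P₄ refl _) (s≤s z≤n)
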